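{- For all integers $m \geq 3$ and $n \geq 1$, $s_{n,m}(112,122)=2^{n-1}$.
   Context: For positive integers $n,m$, $[n]_m$ denotes the regular multiset $\{1^m,2^m,\ldots,n^m\}$ (each element of $[n]=\{1,\dots,n\}$ occurs exactly $m$ times), and a permutation of $[n]_m$ is a sequence of length $nm$ in which each $i\in[n]$ appears exactly $m$ times. A sequence $\sigma=\sigma_1\cdots\sigma_L$ of integers contains a pattern $\pi=\pi_1\cdots\pi_k$ (a sequence of positive integers, possibly with repeated letters) if there are indices $i_1<\dots<i_k$ such that for all $a,b$: $\sigma_{i_a}<\sigma_{i_b}\iff \pi_a<\pi_b$ and $\sigma_{i_a}=\sigma_{i_b}\iff\pi_a=\pi_b$ (i.e. the subsequence is order-isomorphic to $\pi$); otherwise $\sigma$ avoids $\pi$. For a set of patterns $\Pi$, $s_{n,m}(\Pi)$ is the number of permutations of $[n]_m$ avoiding every pattern in $\Pi$. -}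

module Defs where

open import Data.Nat.Base using (ℕ; zero; suc; _*_; _^_; _<_)
open import Data.Nat.Properties using (_≟_; _<?_; suc-injective)
open import Data.Fin.Base as Fin using (Fin; finToFun; funToFin)
import Data.Fin.Properties as Fin
open import Data.List.Base
  using (List; []; _∷_; [_]; map; upTo; length; filter; lookup; cartesianProductWith)
open import Data.List.Properties using (∷-injective)
open import Data.List.Membership.Propositional using (_∈_)
open import Data.List.Membership.Propositional.Properties
  using (∈-filter⁺; ∈-filter⁻; ∈-cartesianProductWith⁺; ∈-cartesianProductWith⁻)
open import Data.List.Relation.Unary.All using (All; []; _∷_; all?)
open import Data.List.Relation.Unary.AllPairs using ([]; _∷_)
open import Data.List.Relation.Unary.Any using (here)
open import Data.List.Relation.Unary.Unique.Propositional using (Unique)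
import Data.List.Relation.Unary.Unique.Propositional.Properties as Unique
open import Data.Product.Base using (∃; _×_; _,_)
open import Function.Base using (_∘_)
open import Function.Bundles using (_⇔_; mk⇔; module Equivalence)
open import Relation.Binary.PropositionalEquality
  using (_≡_; _≗_; refl; sym; cong; subst; subst₂)
open import Relation.Nullary using (¬_; Dec)
open import Relation.Nullary.Decidable using (map′; ¬?; _→-dec_; _×-dec_)

Pattern : Set
Pattern = List ℕ

StrictlyIncreasing : ∀ {k l} → (Fin k → Fin l) → Set
StrictlyIncreasing i = ∀ a b → a Fin.< b → i a Fin.< i b

IsOccurrence : (σ : List ℕ) (π : Pattern) → (Fin (length π) → Fin (length σ)) → Set
IsOccurrence σ π i =
  StrictlyIncreasing i ×
  (∀ a b → (lookup σ (i a) < lookup σ (i b) ⇔ lookup π a < lookup π b) ×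
           (lookup σ (i a) ≡ lookup σ (i b) ⇔ lookup π a ≡ lookup π b))

_Contains_ : List ℕ → Pattern → Set
σ Contains π = ∃ (IsOccurrence σ π)

_Avoids_ : List ℕ → Pattern → Set
σ Avoids π = ¬ (σ Contains π)

_⇔?_ : ∀ {A B : Set} → Dec A → Dec B → Dec (A ⇔ B)
a? ⇔? b? = map′ (λ (f , g) → mk⇔ f g) (λ e → Equivalence.to e , Equivalence.from e)
                ((a? →-dec b?) ×-dec (b? →-dec a?))

isOccurrence? : ∀ σ π i → Dec (IsOccurrence σ π i)
isOccurrence? σ π i =
  Fin.all? (λ a → Fin.all? λ b → (a Fin.<? b) →-dec (i a Fin.<? i b)) ×-dec
  Fin.all? (λ a → Fin.all? λ b →
    ((lookup σ (i a) <? lookup σ (i b)) ⇔? (lookup π a <? lookup π b)) ×-dec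
    ((lookup σ (i a) ≟ lookup σ (i b)) ⇔? (lookup π a ≟ lookup π b)))

isOccurrence-resp-≗ : ∀ σ π {i j} → i ≗ j → IsOccurrence σ π i → IsOccurrence σ π j
isOccurrence-resp-≗ σ π i≗j (inc , iso) =
  (λ a b a<b → subst₂ Fin._<_ (i≗j a) (i≗j b) (inc a b a<b)) ,
  (λ a b → subst₂
    (λ x y → (lookup σ x < lookup σ y ⇔ lookup π a < lookup π b) ×
             (lookup σ x ≡ lookup σ y ⇔ lookup π a ≡ lookup π b))
    (i≗j a) (i≗j b) (iso a b))

contains? : ∀ σ π → Dec (σ Contains π)
contains? σ π = map′
  (λ (c , occ) → finToFun c , occ)
  (λ (i , occ) → funToFin i ,
     isOccurrence-resp-≗ σ π (sym ∘ Fin.finToFun-funToFin i) occ)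
  (Fin.any? (λ (c : Fin (length σ ^ length π)) → isOccurrence? σ π (finToFun c)))

avoids? : ∀ σ π → Dec (σ Avoids π)
avoids? σ π = ¬? (contains? σ π)

⟦_⟧ : ℕ → List ℕ
⟦ n ⟧ = map suc (upTo n)

multiplicity : ℕ → List ℕ → ℕ
multiplicity i σ = length (filter (i ≟_) σ)

EachOccurs : ℕ → ℕ → List ℕ → Set
EachOccurs n m σ = All (λ i → multiplicity i σ ≡ m) ⟦ n ⟧

eachOccurs? : ∀ n m σ → Dec (EachOccurs n m σ)
eachOccurs? n m σ = all? (λ i → multiplicity i σ ≟ m) ⟦ n ⟧

record IsPermutation (n m : ℕ) (σ : List ℕ) : Set where
  constructor isPermutation
  field
    length≡    : length σ ≡ n * m
    letters    : All (_∈ ⟦ n ⟧) σ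
    eachOccurs : EachOccurs n m σ

words : List ℕ → ℕ → List (List ℕ)
words A zero    = [ [] ]
words A (suc l) = cartesianProductWith _∷_ A (words A l)

permutations : ℕ → ℕ → List (List ℕ)
permutations n m = filter (eachOccurs? n m) (words ⟦ n ⟧ (n * m))

s : ℕ → ℕ → List Pattern → ℕ
s n m Π = length (filter (λ σ → all? (avoids? σ) Π) (permutations n m))

-- `permutations n m` lists every permutation of ⟦ n ⟧ with multiplicity m
-- exactly once, so the length taken in `s` is a genuine count.

∈-words⁺ : ∀ {A} σ → All (_∈ A) σ → σ ∈ words A (length σ)
∈-words⁺ []      []         = here refl
∈-words⁺ (x ∷ σ) (x∈A ∷ σ⊆A) = ∈-cartesianProductWith⁺ _∷_ x∈A (∈-words⁺ σ σ⊆A)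

∈-words⁻ : ∀ A l {σ} → σ ∈ words A l → length σ ≡ l × All (_∈ A) σ
∈-words⁻ A zero    (here refl) = refl , []
∈-words⁻ A (suc l) σ∈
  with x , τ , x∈A , τ∈ , refl ← ∈-cartesianProductWith⁻ _∷_ A (words A l) σ∈
  = let len , τ⊆A = ∈-words⁻ A l τ∈ in cong suc len , x∈A ∷ τ⊆A

words-unique : ∀ {A} l → Unique A → Unique (words A l)
words-unique zero    A! = [] ∷ []
words-unique (suc l) A! =
  Unique.cartesianProductWith⁺ _∷_ ∷-injective A! (words-unique l A!)

∈-permutations : ∀ n m {σ} → σ ∈ permutations n m ⇔ IsPermutation n m σ
∈-permutations n m {σ} = mk⇔ to from
  where
  to : σ ∈ permutations n m → IsPermutation n m σ
  to σ∈ =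
    let σ∈words , occ = ∈-filter⁻ (eachOccurs? n m) {xs = words ⟦ n ⟧ (n * m)} σ∈
        len , lets    = ∈-words⁻ ⟦ n ⟧ (n * m) σ∈words
    in isPermutation len lets occ

  from : IsPermutation n m σ → σ ∈ permutations n m
  from (isPermutation len lets occ) =
    ∈-filter⁺ (eachOccurs? n m)
      (subst (λ l → σ ∈ words ⟦ n ⟧ l) len (∈-words⁺ σ lets)) occ

permutations-unique : ∀ n m → Unique (permutations n m)
permutations-unique n m = Unique.filter⁺ (eachOccurs? n m)
  (words-unique (n * m) (Unique.map⁺ suc-injective (Unique.upTo⁺ n)))

{-# OPTIONS --safe #-}
-- For letters i < j, avoiding 112 and 122 forces every j before the second i,
-- with at most one j after the first i.  Hence deleting the copies of the
-- largest letter N from an avoider leaves an avoider a a ⋯, where a = N - 1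
-- because m ≥ 3, and the N's can only be put back as N ⋯ N N a a ⋯ or
-- N ⋯ N a N a ⋯.  Both are avoiders again and, as m ≥ 3, again start with N N,
-- so the number of avoiders doubles with every new letter.
module Submission where

open import Defs
open import Data.Nat.Base
  using (ℕ; zero; suc; _+_; _*_; _^_; _∸_; _≥_; _≤_; _<_; z≤n; s≤s)
open import Data.Nat.Properties
open import Data.Fin.Base as Fin using (Fin; zero; suc)
open import Data.Fin using (#_)
open import Data.List.Base
  using (List; []; _∷_; [_]; _++_; map; length; filter; lookup; replicate; tabulate)
open import Data.List.Properties
  using (filter-all; filter-none; filter-accept; filter-reject; filter-++; length-++;
         length-map; length-replicate; ++-cancelˡ; ++-identityʳ; ∷-injectiveˡ;
         ∷-injectiveʳ; tabulate-cong)
open import Data.List.Membership.Propositional using (_∈_)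
open import Data.List.Membership.Propositional.Properties
open import Data.List.Membership.Propositional.Properties.WithK using (unique∧set⇒bag)
open import Data.List.Relation.Binary.BagAndSetEquality using (∼bag⇒↭)
open import Data.List.Relation.Binary.Disjoint.Propositional using (Disjoint)
open import Data.List.Relation.Binary.Permutation.Propositional
  using (_↭_; ↭-refl; ↭-sym; ↭-trans; ↭-reflexive; swap)
open import Data.List.Relation.Binary.Permutation.Propositional.Properties
  using (↭-length; All-resp-↭; filter-↭; ++⁺ˡ)
open import Data.List.Relation.Binary.Sublist.Propositional
  using (_⊆_; []; _∷_; _∷ʳ_; minimum; ⊆-refl; ⊆-trans; to∈; from∈)
  renaming (lookup to lookup⊆)
open import Data.List.Relation.Binary.Sublist.Propositional.Properties using (filter-⊆)
open import Data.List.Relation.Ternary.Interleaving.Propositional using (toPermutation)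
import Data.List.Relation.Ternary.Interleaving.Propositional.Properties as Interleaving
open import Data.List.Relation.Unary.All as All using (All; []; _∷_; all?)
open import Data.List.Relation.Unary.All.Properties as All
  using (¬Any⇒All¬; all-filter; replicate⁺)
open import Data.List.Relation.Unary.AllPairs using ([]; _∷_)
open import Data.List.Relation.Unary.Any using (here; there)
open import Data.List.Relation.Unary.Unique.Propositional using (Unique)
import Data.List.Relation.Unary.Unique.Propositional.Properties as Unique
open import Data.Product.Base using (∃; _×_; _,_; proj₁; proj₂)
open import Data.Sum.Base using (_⊎_; inj₁; inj₂)
open import Function.Base using (_∘_)
open import Function.Bundles using (_⇔_; mk⇔; module Equivalence)
open import Relation.Binary.Definitions using (tri<; tri≈; tri>)
open import Relation.Binary.PropositionalEquality
  using (_≡_; _≢_; _≗_; refl; sym; trans; cong; cong₂; subst; subst₂; module ≡-Reasoning)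
open import Relation.Nullary using (¬_; yes; no; contradiction)
open import Relation.Nullary.Decidable using (¬?)

open Equivalence using (to; from)

-- Constant blocks, and lengths of duplicate-free lists.

replicate-∷ : ∀ {A : Set} k (x : A) ys → replicate k x ++ x ∷ ys ≡ x ∷ replicate k x ++ ys
replicate-∷ zero    x ys = refl
replicate-∷ (suc k) x ys = cong (x ∷_) (replicate-∷ k x ys)

constant⇒replicate : ∀ {A : Set} {x : A} {xs} → All (_≡ x) xs → xs ≡ replicate (length xs) x
constant⇒replicate []            = refl
constant⇒replicate (refl ∷ xs≡x) = cong (_ ∷_) (constant⇒replicate xs≡x)

-- In a duplicate-free list membership proofs are unique, so equality as sets is equality as bags,
-- and the lists are rearrangements of each other. This reduces the count to a membership
-- equivalence.
unique∧set⇒length : ∀ {A : Set} {xs ys : List A} → Unique xs → Unique ys →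
                    (∀ {x} → x ∈ xs ⇔ x ∈ ys) → length xs ≡ length ys
unique∧set⇒length xs! ys! xs∼ys = ↭-length (∼bag⇒↭ (unique∧set⇒bag xs! ys! xs∼ys))

-- Pattern occurrences as sublists

-- An index map that misses position 0 factors through `suc`; this lets the next induction pass to
-- the tail of the word.
lower-positive : ∀ {k l} (f : Fin k → Fin (suc l)) → StrictlyIncreasing f →
                 (∀ a → zero {l} Fin.< f a) →
                 ∃ λ (g : Fin k → Fin l) → f ≗ suc ∘ g × StrictlyIncreasing g
lower-positive f inc pos = (λ a → proj₁ (pred (f a) (pos a))) , f≗ ,
  λ a b a<b → ≤-pred (subst₂ Fin._<_ (f≗ a) (f≗ b) (inc a b a<b))
  where
  pred : ∀ {l} (i : Fin (suc l)) → zero {l} Fin.< i → ∃ λ j → i ≡ suc j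
  pred (suc j) _ = j , refl
  f≗ : f ≗ suc ∘ λ a → proj₁ (pred (f a) (pos a))
  f≗ a = proj₂ (pred (f a) (pos a))

-- Split on whether the first index is 0. If it is, the head is kept and strict increase makes all
-- later indices positive; if not, every index is positive and the head is skipped.
increasing⇒⊆ : ∀ {A : Set} {k} (xs : List A) (f : Fin k → Fin (length xs)) →
               StrictlyIncreasing f → tabulate (lookup xs ∘ f) ⊆ xs
increasing⇒⊆ {k = zero}  xs f inc = minimum xs
increasing⇒⊆ {k = suc k} [] f inc with () ← f zero
increasing⇒⊆ {k = suc k} (x ∷ xs) f inc with f zero in f0≡
... | zero  =
  let g , f≗ , g-inc = lower-positive (f ∘ suc) (λ a b a<b → inc (suc a) (suc b) (s≤s a<b))
                         (λ a → subst (Fin._< f (suc a)) f0≡ (inc zero (suc a) (s≤s z≤n)))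
  in refl ∷ subst (_⊆ xs) (sym (tabulate-cong (cong (lookup (x ∷ xs)) ∘ f≗)))
              (increasing⇒⊆ xs g g-inc)
... | suc i =
  let pos : ∀ a → zero {length xs} Fin.< f a
      pos = λ { zero    → subst (zero {length xs} Fin.<_) (sym f0≡) (s≤s z≤n)
              ; (suc a) → ≤-trans (s≤s z≤n) (inc zero (suc a) (s≤s z≤n)) }
      g , f≗ , g-inc = lower-positive f inc pos
  in x ∷ʳ subst (_⊆ xs)
       (trans (sym (tabulate-cong (cong (lookup (x ∷ xs)) ∘ f≗)))
              (cong (λ j → lookup (x ∷ xs) j ∷ tabulate (lookup (x ∷ xs) ∘ f ∘ suc)) f0≡))
       (increasing⇒⊆ xs g g-inc)

-- The relabelling `g` is kept apart from `xs` so that the index map has the positions of the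
-- pattern itself as its domain.
⊆⇒increasing : ∀ {A B : Set} (g : A → B) {xs} {ys} → map g xs ⊆ ys →
               ∃ λ (f : Fin (length xs) → Fin (length ys)) →
                 StrictlyIncreasing f × (∀ a → lookup ys (f a) ≡ g (lookup xs a))
⊆⇒increasing g {[]} _ = (λ ()) , (λ ()) , (λ ())
⊆⇒increasing g {x ∷ xs} (y ∷ʳ τ) =
  let f , inc , eq = ⊆⇒increasing g {x ∷ xs} τ
  in suc ∘ f , (λ a b a<b → s≤s (inc a b a<b)) , eq
⊆⇒increasing g {x ∷ xs} {y ∷ ys} (refl ∷ τ) =
  let f , inc , eq = ⊆⇒increasing g {xs} τ
      h : Fin (suc (length xs)) → Fin (suc (length ys))
      h = λ { zero → zero ; (suc a) → suc (f a) }
  in h , (λ { zero    (suc b) _         → s≤s z≤n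
            ; (suc a) (suc b) (s≤s a<b) → s≤s (inc a b a<b) }) ,
     (λ { zero → refl ; (suc a) → eq a })

-- By trichotomy, a relabelling that is strictly monotone on the letters of `π` also reflects both
-- order and equality, which is order-isomorphism.
monotone-⊆⇒contains : ∀ (g : ℕ → ℕ) {σ π} →
                      (∀ {x y} → x ∈ π → y ∈ π → x < y → g x < g y) →
                      map g π ⊆ σ → σ Contains π
monotone-⊆⇒contains g {σ} {π} mono π⊆σ =
  let f , inc , eq = ⊆⇒increasing g {π} π⊆σ
  in f , inc , λ a b → subst₂
       (λ x y → (x < y ⇔ lookup π a < lookup π b) × (x ≡ y ⇔ lookup π a ≡ lookup π b))
       (sym (eq a)) (sym (eq b)) (iso (∈-lookup {xs = π} a) (∈-lookup {xs = π} b))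
  where
  iso : ∀ {x y} → x ∈ π → y ∈ π → (g x < g y ⇔ x < y) × (g x ≡ g y ⇔ x ≡ y)
  iso {x} {y} x∈ y∈ with <-cmp x y
  ... | tri< x<y x≢y _ =
    mk⇔ (λ _ → x<y) (λ _ → mono x∈ y∈ x<y) ,
    mk⇔ (λ e → contradiction e (<⇒≢ (mono x∈ y∈ x<y))) (λ e → contradiction e x≢y)
  ... | tri≈ x≮y refl _ =
    mk⇔ (λ l → contradiction l (<-irrefl refl)) (λ l → contradiction l x≮y) ,
    mk⇔ (λ _ → refl) (λ _ → refl)
  ... | tri> x≮y x≢y y<x =
    mk⇔ (λ l → contradiction l (<-asym (mono y∈ x∈ y<x))) (λ l → contradiction l x≮y) ,
    mk⇔ (λ e → contradiction (sym e) (<⇒≢ (mono y∈ x∈ y<x))) (λ e → contradiction e x≢y)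

-- Avoidance of 112 and 122 as a condition on sublists.

Patterns : List Pattern
Patterns = (1 ∷ 1 ∷ 2 ∷ []) ∷ (1 ∷ 2 ∷ 2 ∷ []) ∷ []

-- Naming the actual letters removes the index maps from avoidance, and inheritance by sublists
-- becomes transitivity of `_⊆_`.
Good : List ℕ → Set
Good σ = ∀ {i j} → i < j → ¬ (i ∷ i ∷ j ∷ [] ⊆ σ) × ¬ (i ∷ j ∷ j ∷ [] ⊆ σ)

good-⊆ : ∀ {σ τ} → σ ⊆ τ → Good τ → Good σ
good-⊆ σ⊆τ good i<j =
  (λ p → proj₁ (good i<j) (⊆-trans p σ⊆τ)) , (λ p → proj₂ (good i<j) (⊆-trans p σ⊆τ))

-- An occurrence yields a three-letter sublist, and the repeated pattern letter forces two of its
-- entries to be equal. Conversely, a sublist on `i < j` is the pattern relabelled by 1 to `i` and 2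
-- to `j`.
good⇔avoids : ∀ {σ} → Good σ ⇔ All (σ Avoids_) Patterns
good⇔avoids {σ} = mk⇔
  (λ good →
    (λ (f , inc , iso) → proj₁ (good (from (proj₁ (iso (# 0) (# 2))) (s≤s (s≤s z≤n))))
      (subst (λ x → lookup σ (f (# 0)) ∷ x ∷ lookup σ (f (# 2)) ∷ [] ⊆ σ)
             (sym (from (proj₂ (iso (# 0) (# 1))) refl))
        (increasing⇒⊆ σ f inc))) ∷
    (λ (f , inc , iso) → proj₂ (good (from (proj₁ (iso (# 0) (# 1))) (s≤s (s≤s z≤n))))
      (subst (λ x → lookup σ (f (# 0)) ∷ lookup σ (f (# 1)) ∷ x ∷ [] ⊆ σ)
             (sym (from (proj₂ (iso (# 1) (# 2))) refl))
        (increasing⇒⊆ σ f inc))) ∷ [])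
  (λ { (avoids112 ∷ avoids122 ∷ []) {i} {j} i<j →
    (λ p → avoids112 (monotone-⊆⇒contains (relabel i j)
       (λ x∈ y∈ → mono i<j (one-or-two₁ x∈) (one-or-two₁ y∈)) p)) ,
    (λ p → avoids122 (monotone-⊆⇒contains (relabel i j)
       (λ x∈ y∈ → mono i<j (one-or-two₂ x∈) (one-or-two₂ y∈)) p)) })
  where
  relabel : ℕ → ℕ → ℕ → ℕ
  -- Both patterns use only the letters 1 and 2, so the catch-all clause serves as the value at 2.
  relabel i j 1 = i
  relabel i j _ = j

  one-or-two₁ : ∀ {x} → x ∈ 1 ∷ 1 ∷ 2 ∷ [] → x ≡ 1 ⊎ x ≡ 2
  one-or-two₁ = All.lookup {P = λ x → x ≡ 1 ⊎ x ≡ 2} (inj₁ refl ∷ inj₁ refl ∷ inj₂ refl ∷ [])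

  one-or-two₂ : ∀ {x} → x ∈ 1 ∷ 2 ∷ 2 ∷ [] → x ≡ 1 ⊎ x ≡ 2
  one-or-two₂ = All.lookup {P = λ x → x ≡ 1 ⊎ x ≡ 2} (inj₁ refl ∷ inj₂ refl ∷ inj₂ refl ∷ [])

  mono : ∀ {i j x y} → i < j → x ≡ 1 ⊎ x ≡ 2 → y ≡ 1 ⊎ y ≡ 2 →
         x < y → relabel i j x < relabel i j y
  mono i<j (inj₁ refl) (inj₁ refl) 1<1 = contradiction 1<1 (<-irrefl refl)
  mono i<j (inj₁ refl) (inj₂ refl) _   = i<j
  mono i<j (inj₂ refl) (inj₁ refl) 2<1 = contradiction 2<1 (<-asym (s≤s (s≤s z≤n)))
  mono i<j (inj₂ refl) (inj₂ refl) 2<2 = contradiction 2<2 (<-irrefl refl)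

-- Inserting copies of a largest letter.

-- Both patterns begin with their smaller letter, so an occurrence starting at the new `N` would
-- need a letter above `N` in `σ`.
good-∷-max : ∀ {N σ} → All (_≤ N) σ → Good σ → Good (N ∷ σ)
good-∷-max {N} {σ} σ≤N good i<j =
  (λ { (_ ∷ʳ p) → proj₁ (good i<j) p
     ; (refl ∷ p) → below (there (here refl)) i<j p }) ,
  (λ { (_ ∷ʳ p) → proj₂ (good i<j) p
     ; (refl ∷ p) → below (here refl) i<j p })
  where
  below : ∀ {x xs} → x ∈ xs → N < x → ¬ (xs ⊆ σ)
  below x∈ N<x p = <⇒≱ N<x (All.lookup σ≤N (lookup⊆ p x∈))

good-replicate-max : ∀ {N σ} k → All (_≤ N) σ → Good σ → Good (replicate k N ++ σ)
good-replicate-max zero    σ≤N good = good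
good-replicate-max (suc k) σ≤N good =
  good-∷-max (All.++⁺ (replicate⁺ k ≤-refl) σ≤N) (good-replicate-max k σ≤N good)

-- An occurrence lies in `N ∷ v` or in `a ∷ v` unless it uses both `a` and `N`. In that case 112
-- would force `a` to equal `N`, and 122 would need a second `N` inside `v`.
good-swap-max : ∀ {N a v} → All (_< N) (a ∷ v) → Good (a ∷ v) → Good (a ∷ N ∷ v)
good-swap-max {N} {a} {v} (a<N ∷ v<N) good i<j =
  (λ { (_ ∷ʳ p) → proj₁ (good-Nv i<j) p
     ; (refl ∷ (_ ∷ʳ p)) → proj₁ (good i<j) (refl ∷ p)
     ; (refl ∷ (refl ∷ p)) → <-irrefl refl a<N }) ,
  (λ { (_ ∷ʳ p) → proj₂ (good-Nv i<j) p
     ; (refl ∷ (_ ∷ʳ p)) → proj₂ (good i<j) (refl ∷ p)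
     ; (refl ∷ (refl ∷ p)) → <-irrefl refl (All.lookup v<N (to∈ p)) })
  where
  good-Nv : Good (N ∷ v)
  good-Nv = good-∷-max (All.map <⇒≤ v<N) (good-⊆ (a ∷ʳ ⊆-refl) good)

-- Deleting the largest letter and the ways to put it back.

without : ℕ → List ℕ → List ℕ
without N = filter (¬? ∘ (N ≟_))

without-≡ : ∀ {N σ} → ¬ ([ N ] ⊆ σ) → without N σ ≡ σ
without-≡ N⊈σ = filter-all _ (¬Any⇒All¬ _ (N⊈σ ∘ from∈))

without-∷≡ : ∀ {N x σ} → N ≢ x → without N (x ∷ σ) ≡ x ∷ without N σ
without-∷≡ N≢x = filter-accept (¬? ∘ (_ ≟_)) N≢x

without-max : ∀ N σ → without N (N ∷ σ) ≡ without N σ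
without-max N σ = filter-reject (¬? ∘ (N ≟_)) (λ N≢N → N≢N refl)

-- This describes the word after its first `a`, where a further `a N` would complete 112 and a
-- further `N N` would complete 122. Hence a leading `N` is the only one, and a leading `a` has no
-- `N` after it.
reinsert-after-one : ∀ {N a w} σ → ¬ (a ∷ N ∷ [] ⊆ σ) → ¬ (N ∷ N ∷ [] ⊆ σ) →
                     without N σ ≡ a ∷ w → σ ≡ a ∷ w ⊎ σ ≡ N ∷ a ∷ w
reinsert-after-one {N} {a} {w} (x ∷ σ) aN⊈ NN⊈ eq with N ≟ x
... | yes refl = inj₂ (cong (N ∷_) (begin
  σ                 ≡⟨ without-≡ (λ p → NN⊈ (refl ∷ p)) ⟨
  without N σ       ≡⟨ without-max N σ ⟨
  without N (N ∷ σ) ≡⟨ eq ⟩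
  a ∷ w             ∎))
  where open ≡-Reasoning
... | no N≢x with refl ← ∷-injectiveˡ (trans (sym (without-∷≡ N≢x)) eq) = inj₁ (begin
  a ∷ σ             ≡⟨ cong (a ∷_) (without-≡ (λ p → aN⊈ (refl ∷ p))) ⟨
  a ∷ without N σ   ≡⟨ without-∷≡ N≢x ⟨
  without N (a ∷ σ) ≡⟨ eq ⟩
  a ∷ w             ∎)
  where open ≡-Reasoning

-- Leading copies of `N` are peeled off and counted by `k`. The first other letter survives the
-- deletion, so it is the first `a`, and `reinsert-after-one` settles what follows.
reinsert : ∀ {N a w} σ → a < N → Good σ → without N σ ≡ a ∷ a ∷ w →
           ∃ λ k → σ ≡ replicate k N ++ a ∷ a ∷ w ⊎ σ ≡ replicate k N ++ a ∷ N ∷ a ∷ w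
reinsert {N} {a} {w} (x ∷ σ) a<N good eq with N ≟ x
... | yes refl with reinsert σ a<N (good-⊆ (N ∷ʳ ⊆-refl) good) (trans (sym (without-max N σ)) eq)
... | k , inj₁ σ≡ = suc k , inj₁ (cong (N ∷_) σ≡)
... | k , inj₂ σ≡ = suc k , inj₂ (cong (N ∷_) σ≡)
reinsert {N} {a} {w} (x ∷ σ) a<N good eq | no N≢x
  with refl ← ∷-injectiveˡ (trans (sym (without-∷≡ N≢x)) eq)
  with reinsert-after-one σ (λ p → proj₁ (good a<N) (refl ∷ p))
         (λ p → proj₂ (good a<N) (refl ∷ p))
         (∷-injectiveʳ (trans (sym (without-∷≡ N≢x)) eq))
... | inj₁ σ≡ = 0 , inj₁ (cong (a ∷_) σ≡)
... | inj₂ σ≡ = 0 , inj₂ (cong (a ∷_) σ≡)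

-- Multiset permutations

∈-⟦⟧⁺ : ∀ {n i} → i < n → suc i ∈ ⟦ n ⟧
∈-⟦⟧⁺ i<n = ∈-map⁺ suc (∈-upTo⁺ i<n)

∈-⟦⟧⁻ : ∀ {n x} → x ∈ ⟦ n ⟧ → ∃ λ i → i < n × x ≡ suc i
∈-⟦⟧⁻ x∈ = let i , i∈ , x≡ = ∈-map⁻ suc x∈ in i , ∈-upTo⁻ i∈ , x≡

∈-⟦⟧⇒≤ : ∀ {n x} → x ∈ ⟦ n ⟧ → x ≤ n
∈-⟦⟧⇒≤ x∈ with _ , i<n , refl ← ∈-⟦⟧⁻ x∈ = i<n

∈-⟦suc⟧⁺ : ∀ {n x} → x ∈ ⟦ n ⟧ → x ∈ ⟦ suc n ⟧
∈-⟦suc⟧⁺ x∈ with _ , i<n , refl ← ∈-⟦⟧⁻ x∈ = ∈-⟦⟧⁺ (m≤n⇒m≤1+n i<n)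

multiplicity-++ : ∀ i σ τ → multiplicity i (σ ++ τ) ≡ multiplicity i σ + multiplicity i τ
multiplicity-++ i σ τ = trans (cong length (filter-++ (i ≟_) σ τ)) (length-++ (filter (i ≟_) σ))

multiplicity-↭ : ∀ i {σ τ} → σ ↭ τ → multiplicity i σ ≡ multiplicity i τ
multiplicity-↭ i σ↭τ = ↭-length (filter-↭ (i ≟_) σ↭τ)

multiplicity-none : ∀ {i σ} → All (i ≢_) σ → multiplicity i σ ≡ 0
multiplicity-none i∉σ = cong length (filter-none (_ ≟_) i∉σ)

multiplicity-replicate : ∀ k N → multiplicity N (replicate k N) ≡ k
multiplicity-replicate k N =
  trans (cong length (filter-all (N ≟_) (replicate⁺ k refl))) (length-replicate k)

multiplicity-replicate-++ : ∀ {N τ} k → All (N ≢_) τ → multiplicity N (replicate k N ++ τ) ≡ k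
multiplicity-replicate-++ {N} {τ} k N∉τ = begin
  multiplicity N (replicate k N ++ τ)                ≡⟨ multiplicity-++ N (replicate k N) τ ⟩
  multiplicity N (replicate k N) + multiplicity N τ
    ≡⟨ cong₂ _+_ (multiplicity-replicate k N) (multiplicity-none N∉τ) ⟩
  k + 0                                              ≡⟨ +-identityʳ k ⟩
  k                                                  ∎
  where open ≡-Reasoning

≢-max : ∀ {n τ} → All (_∈ ⟦ n ⟧) τ → All (suc n ≢_) τ
≢-max = All.map λ x∈ e → <⇒≢ (s≤s (∈-⟦⟧⇒≤ x∈)) (sym e)

-- Stated up to rearrangement, so that it serves every placement of the new letter.
add-max : ∀ {n m σ τ} → IsPermutation n m τ → σ ↭ replicate m (suc n) ++ τ →
          IsPermutation (suc n) m σ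
add-max {n} {m} {σ} {τ} (isPermutation len lets occ) σ↭ = isPermutation
  (begin
    length σ                                ≡⟨ ↭-length σ↭ ⟩
    length (replicate m (suc n) ++ τ)       ≡⟨ length-++ (replicate m (suc n)) ⟩
    length (replicate m (suc n)) + length τ ≡⟨ cong₂ _+_ (length-replicate m) len ⟩
    m + n * m                               ∎)
  (All-resp-↭ (↭-sym σ↭) (All.++⁺ (replicate⁺ m (∈-⟦⟧⁺ ≤-refl)) (All.map ∈-⟦suc⟧⁺ lets)))
  (All.tabulate λ i∈ → trans (multiplicity-↭ _ σ↭) (count i∈))
  where
  open ≡-Reasoning

  count : ∀ {i} → i ∈ ⟦ suc n ⟧ → multiplicity i (replicate m (suc n) ++ τ) ≡ m
  count i∈ with i , i<1+n , refl ← ∈-⟦⟧⁻ i∈ with i ≟ n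
  ... | yes refl = multiplicity-replicate-++ m (≢-max lets)
  ... | no i≢n   = begin
    multiplicity (suc i) (replicate m (suc n) ++ τ)
      ≡⟨ multiplicity-++ (suc i) (replicate m (suc n)) τ ⟩
    multiplicity (suc i) (replicate m (suc n)) + multiplicity (suc i) τ
      ≡⟨ cong₂ _+_ (multiplicity-none (replicate⁺ m (i≢n ∘ suc-injective)))
                   (All.lookup occ (∈-⟦⟧⁺ (≤∧≢⇒< (≤-pred i<1+n) i≢n))) ⟩
    m ∎

-- By `split`, the copies of the largest letter and the remaining word together rearrange `σ`.
-- Cancelling the `m` copies gives the length, and the multiplicity of every smaller letter is
-- unchanged.
remove-max : ∀ {n m σ} → IsPermutation (suc n) m σ → IsPermutation n m (without (suc n) σ)
remove-max {n} {m} {σ} (isPermutation len lets occ) = isPermutation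
  (+-cancelˡ-≡ m _ _ (begin
    m + length (without (suc n) σ)                      ≡⟨ cong (_+ _) (All.lookup occ (∈-⟦⟧⁺ ≤-refl)) ⟨
    multiplicity (suc n) σ + length (without (suc n) σ) ≡⟨ length-++ (filter (suc n ≟_) σ) ⟨
    length (filter (suc n ≟_) σ ++ without (suc n) σ)   ≡⟨ ↭-length split ⟨
    length σ                                            ≡⟨ len ⟩
    m + n * m                                           ∎))
  (All.tabulate λ x∈ →
    let x∈σ , N≢x = ∈-filter⁻ (¬? ∘ (suc n ≟_)) {xs = σ} x∈
    in strengthen N≢x (All.lookup lets x∈σ))
  (All.tabulate λ {i} i∈ → begin
    multiplicity i (without (suc n) σ)
      ≡⟨ cong (_+ multiplicity i (without (suc n) σ))
              (multiplicity-none (All.map (λ { refl refl → <-irrefl refl (∈-⟦⟧⇒≤ i∈) })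
                                          (all-filter (suc n ≟_) σ))) ⟨
    multiplicity i (filter (suc n ≟_) σ) + multiplicity i (without (suc n) σ)
      ≡⟨ multiplicity-++ i (filter (suc n ≟_) σ) _ ⟨
    multiplicity i (filter (suc n ≟_) σ ++ without (suc n) σ)
      ≡⟨ multiplicity-↭ i split ⟨
    multiplicity i σ
      ≡⟨ All.lookup occ (∈-⟦suc⟧⁺ i∈) ⟩
    m ∎)
  where
  open ≡-Reasoning

  split : σ ↭ filter (suc n ≟_) σ ++ without (suc n) σ
  split = toPermutation (Interleaving.filter⁺ (suc n ≟_) σ)

  strengthen : ∀ {x} → suc n ≢ x → x ∈ ⟦ suc n ⟧ → x ∈ ⟦ n ⟧
  strengthen N≢x x∈ with i , i<1+n , refl ← ∈-⟦⟧⁻ x∈ =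
    ∈-⟦⟧⁺ (≤∧≢⇒< (≤-pred i<1+n) (λ i≡n → N≢x (cong suc (sym i≡n))))

isPermutation-1 : ∀ m → IsPermutation 1 m (replicate m 1)
isPermutation-1 m =
  -- The starting point is the empty word, a permutation on no letters.
  add-max (isPermutation refl [] []) (↭-reflexive (sym (++-identityʳ (replicate m 1))))

isPermutation-1⁻ : ∀ {m σ} → IsPermutation 1 m σ → σ ≡ replicate m 1
isPermutation-1⁻ {m} {σ} (isPermutation len lets _) = begin
  σ                      ≡⟨ constant⇒replicate (All.map (λ { (here x≡1) → x≡1 }) lets) ⟩
  replicate (length σ) 1 ≡⟨ cong (λ l → replicate l 1) (trans len (*-identityˡ m)) ⟩
  replicate m 1          ∎
  where open ≡-Reasoning

-- An avoider starts with its largest letter, which is omitted in stacked,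
-- swapped and tails.  The multiplicity is m = 3 + k, and the letters are
-- 1, …, n + 1.

stacked swapped : ℕ → ℕ → List ℕ → List ℕ
stacked k n v = replicate (1 + k) (2 + n) ++ 2 + n ∷ 1 + n ∷ v
swapped k n v = replicate (1 + k) (2 + n) ++ 1 + n ∷ 2 + n ∷ v

tails : ℕ → ℕ → List (List ℕ)
tails k zero    = [ replicate (2 + k) 1 ]
tails k (suc n) = map (stacked k n) (tails k n) ++ map (swapped k n) (tails k n)

avoiders : ℕ → ℕ → List (List ℕ)
avoiders k n = map (suc n ∷_) (tails k n)

length-tails : ∀ k n → length (tails k n) ≡ 2 ^ n
length-tails k zero    = refl
length-tails k (suc n) = begin
  length (map (stacked k n) (tails k n) ++ map (swapped k n) (tails k n))
    ≡⟨ length-++ (map (stacked k n) (tails k n)) ⟩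
  length (map (stacked k n) (tails k n)) + length (map (swapped k n) (tails k n))
    ≡⟨ cong₂ _+_ (length-map (stacked k n) (tails k n)) (length-map (swapped k n) (tails k n)) ⟩
  length (tails k n) + length (tails k n)
    ≡⟨ cong (λ l → l + l) (length-tails k n) ⟩
  2 ^ n + 2 ^ n
    ≡⟨ cong (2 ^ n +_) (+-identityʳ (2 ^ n)) ⟨
  2 ^ suc n ∎
  where open ≡-Reasoning

tails-unique : ∀ k n → Unique (tails k n)
tails-unique k zero    = [] ∷ []
tails-unique k (suc n) = Unique.++⁺
  (Unique.map⁺ (λ e → ∷-injectiveʳ (∷-injectiveʳ (cancel e))) (tails-unique k n))
  (Unique.map⁺ (λ e → ∷-injectiveʳ (∷-injectiveʳ (cancel e))) (tails-unique k n))
  disjoint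
  where
  -- Both shapes share a prefix of `1 + k` copies. Once it is cancelled, the next letter is `2 + n`
  -- in one and `1 + n` in the other, which separates them.
  cancel : ∀ {u v} → replicate (1 + k) (2 + n) ++ u ≡ replicate (1 + k) (2 + n) ++ v → u ≡ v
  cancel = ++-cancelˡ (replicate (1 + k) (2 + n)) _ _

  disjoint : Disjoint (map (stacked k n) (tails k n)) (map (swapped k n) (tails k n))
  disjoint (x∈₁ , x∈₂) =
    let _ , _ , x≡₁ = ∈-map⁻ (stacked k n) x∈₁
        _ , _ , x≡₂ = ∈-map⁻ (swapped k n) x∈₂
    in 1+n≢n (∷-injectiveˡ (cancel (trans (sym x≡₁) x≡₂)))

∈-tails-suc⁻ : ∀ k n {v} → v ∈ tails k (suc n) →
               ∃ λ u → u ∈ tails k n × (v ≡ stacked k n u ⊎ v ≡ swapped k n u)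
∈-tails-suc⁻ k n v∈ with ∈-++⁻ (map (stacked k n) (tails k n)) v∈
... | inj₁ v∈ˡ = let u , u∈ , v≡ = ∈-map⁻ (stacked k n) v∈ˡ in u , u∈ , inj₁ v≡
... | inj₂ v∈ʳ = let u , u∈ , v≡ = ∈-map⁻ (swapped k n) v∈ʳ in u , u∈ , inj₂ v≡

-- With the omitted first letter, this gives the two equal leading letters that `reinsert` asks for.
-- Multiplicity at least 3 enters here: even after one copy has moved past `1 + n`, two remain in
-- front.
tails-head : ∀ k n {v} → v ∈ tails k n → ∃ λ w → v ≡ suc n ∷ w
tails-head k zero    (here refl) = _ , refl
tails-head k (suc n) v∈ with ∈-tails-suc⁻ k n v∈
... | _ , _ , inj₁ refl = _ , refl
... | _ , _ , inj₂ refl = _ , refl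

-- Every listed word is an avoider.

stacked-≡ : ∀ k n v → 2 + n ∷ stacked k n v ≡ replicate (3 + k) (2 + n) ++ 1 + n ∷ v
stacked-≡ k n v = cong (2 + n ∷_) (replicate-∷ (1 + k) (2 + n) (1 + n ∷ v))

swapped-↭ : ∀ k N a (v : List ℕ) → replicate k N ++ a ∷ N ∷ v ↭ replicate (suc k) N ++ a ∷ v
swapped-↭ k N a v = ↭-trans
  (++⁺ˡ (replicate k N) (swap a N ↭-refl))
  (↭-reflexive (replicate-∷ k N (a ∷ v)))

tails-sound : ∀ k n {v} → v ∈ tails k n →
              IsPermutation (suc n) (3 + k) (suc n ∷ v) × Good (suc n ∷ v)
tails-sound k zero (here refl) = isPermutation-1 (3 + k) ,
  subst Good (++-identityʳ (replicate (3 + k) 1))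
    (good-replicate-max (3 + k) [] (λ _ → (λ ()) , (λ ())))
tails-sound k (suc n) v∈ with u , u∈ , v≡ ← ∈-tails-suc⁻ k n v∈
  with perm , good ← tails-sound k n u∈ | v≡
... | inj₁ refl =
  add-max perm (↭-reflexive (stacked-≡ k n u)) ,
  subst Good (sym (stacked-≡ k n u))
    (good-replicate-max (3 + k) (All.map (m≤n⇒m≤1+n ∘ ∈-⟦⟧⇒≤) (letters perm)) good)
  where open IsPermutation
... | inj₂ refl =
  -- The omitted first letter joins the `1 + k` copies of `swapped` to make a front block of
  -- `2 + k`; the last copy stands after `1 + n`.
  add-max perm (swapped-↭ (2 + k) (2 + n) (1 + n) u) ,
  good-replicate-max (2 + k) (n≤1+n _ ∷ ≤-refl ∷ All.map <⇒≤ (All.tail u<))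
    (good-swap-max u< good)
  where
  open IsPermutation
  u< : All (_< 2 + n) (1 + n ∷ u)
  u< = All.map (s≤s ∘ ∈-⟦⟧⇒≤) (letters perm)

avoiders-sound : ∀ k n {σ} → σ ∈ avoiders k n → IsPermutation (suc n) (3 + k) σ × Good σ
avoiders-sound k n σ∈ with _ , v∈ , refl ← ∈-map⁻ (suc n ∷_) σ∈ = tails-sound k n v∈

-- Every avoider is listed.

without-∌max : ∀ {n m σ τ} → IsPermutation (suc n) m σ → without (suc n) σ ≡ τ → All (suc n ≢_) τ
without-∌max perm refl = ≢-max (IsPermutation.letters (remove-max perm))

max-occurs : ∀ {n m σ} → IsPermutation (suc n) m σ → multiplicity (suc n) σ ≡ m
max-occurs perm = All.lookup (IsPermutation.eachOccurs perm) (∈-⟦⟧⁺ ≤-refl)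

-- Induction by deleting the largest letter: the shorter word is listed and starts with a doubled
-- letter, so `reinsert` leaves two shapes with an unknown number `j` of leading copies, which the
-- multiplicity determines.
avoiders-complete : ∀ k n {σ} → IsPermutation (suc n) (3 + k) σ → Good σ → σ ∈ avoiders k n
avoiders-complete k zero    perm good = here (isPermutation-1⁻ perm)
avoiders-complete k (suc n) {σ} perm good
  with v , v∈ , σ⁻≡ ← ∈-map⁻ (suc n ∷_)
         (avoiders-complete k n (remove-max perm)
            (good-⊆ (filter-⊆ (¬? ∘ (2 + n ≟_)) σ) good))
  with w , refl ← tails-head k n v∈
  with reinsert σ ≤-refl good σ⁻≡
... | j , inj₁ refl
  -- All copies are in front, so `j` is `3 + k`.
  with refl ← trans (sym (multiplicity-replicate-++ j (without-∌max perm σ⁻≡))) (max-occurs perm)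
  = subst (_∈ avoiders k (suc n)) (stacked-≡ k n (1 + n ∷ w))
      (∈-map⁺ (2 + n ∷_) (∈-++⁺ˡ (∈-map⁺ (stacked k n) v∈)))
... | j , inj₂ refl
  -- One copy stands behind `1 + n`, so `suc j` is `3 + k`.
  with refl ← trans (sym (trans (multiplicity-↭ (2 + n) (swapped-↭ j (2 + n) (1 + n) (1 + n ∷ w)))
                                (multiplicity-replicate-++ (suc j) (without-∌max perm σ⁻≡))))
                    (max-occurs perm)
  = ∈-map⁺ (2 + n ∷_) (∈-++⁺ʳ _ (∈-map⁺ (swapped k n) v∈))

-- The filtered permutations and `avoiders` are duplicate-free lists with the same members, and the
-- second has length `2 ^ n` for `n + 1` letters.
theorem1 : (m n : ℕ) → m ≥ 3 → n ≥ 1 →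
    s n m ((1 ∷ 1 ∷ 2 ∷ []) ∷ (1 ∷ 2 ∷ 2 ∷ []) ∷ []) ≡ 2 ^ (n ∸ 1)
theorem1 (suc (suc (suc k))) (suc n) (s≤s (s≤s (s≤s z≤n))) (s≤s z≤n) = begin
  s (suc n) (3 + k) Patterns ≡⟨ unique∧set⇒length
                                  (Unique.filter⁺ avoids-all? (permutations-unique (suc n) (3 + k)))
                                  (Unique.map⁺ ∷-injectiveʳ (tails-unique k n))
                                  (mk⇔ sound complete) ⟩
  length (avoiders k n)      ≡⟨ length-map (suc n ∷_) (tails k n) ⟩
  length (tails k n)         ≡⟨ length-tails k n ⟩
  2 ^ n                      ∎
  where
  open ≡-Reasoning
  avoids-all? = λ σ → all? (avoids? σ) Patterns

  sound : ∀ {σ} → σ ∈ filter avoids-all? (permutations (suc n) (3 + k)) → σ ∈ avoiders k n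
  sound σ∈ =
    let σ∈perms , avoids = ∈-filter⁻ avoids-all? {xs = permutations (suc n) (3 + k)} σ∈
    in avoiders-complete k n (to (∈-permutations _ _) σ∈perms) (from good⇔avoids avoids)

  complete : ∀ {σ} → σ ∈ avoiders k n → σ ∈ filter avoids-all? (permutations (suc n) (3 + k))
  complete σ∈ =
    let perm , good = avoiders-sound k n σ∈
    in ∈-filter⁺ avoids-all? (from (∈-permutations _ _) perm) (to good⇔avoids good)
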